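{- Let $k, d \in \mathbb{N}$. Every digraph $D$ with $\delta^+(D) > (d+2)(k-1)$ and directed tree-width at most $d$ contains $k$ pairwise vertex-disjoint directed cycles of pairwise distinct lengths.
   Context: $\mathbb{N}$ denotes the positive integers. Digraphs are finite (and non-empty), have no loops and no parallel arcs, but may contain anti-parallel pairs of arcs (digons, which count as directed cycles of length $2$). $\delta^+(D)$ is the minimum out-degree of $D$. Directed tree-width. An out-arborescence $T$ is a directed rooted tree with all arcs directed away from the root. For $r,r'\in V(T)$ write $r\le r'$ if $r'$ is reachable from $r$ in $T$ (possibly $r=r'$); for an arc $e\in A(T)$ with head $r$, write $e<r'$ if $r\le r'$. For a digraph $D$ and $Z\subseteq V(D)$, a set $S\subseteq V(D)\setminus Z$ is $Z$-normal if the vertex set of every directed walk in $D-Z$ which starts and ends in $S$ is contained in $S$. A directed tree-decomposition of $D$ is a triple $(T,\beta,\gamma)$ where $T$ is an out-arborescence and $\beta:V(T)\to 2^{V(D)}$, $\gamma:A(T)\to 2^{V(D)}$ are functions such that (i) $\{\beta(t)\mid t\in V(T)\}$ is a partition of $V(D)$ into non-empty sets (one for each $t$), and (ii) for every $e\in A(T)$ the set $\bigcup\{\beta(t)\mid t\in V(T), e<t\}$ is $\gamma(e)$-normal. For $t\in V(T)$ let $\Gamma(t):=\beta(t)\cup\bigcup\{\gamma(e)\mid e\in A(T),\ e \text{ incident with } t\}$. The width of $(T,\beta,\gamma)$ is $\max_{t\in V(T)}|\Gamma(t)|-1$. The directed tree-width $\mathrm{dtw}(D)$ is the smallest width of a directed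 tree-decomposition of $D$. -}

module Defs where

open import Data.Fin using (Fin)
open import Data.Fin.Subset using (Subset; _∈_; _∉_; _∪_; ⋃; ∣_∣; Nonempty; ⊥)
open import Data.Fin.Subset.Properties using (_∈?_)
open import Data.List using (List; []; _∷_; length; map; allFin)
open import Data.List.Extrema.Nat using (max; min)
open import Data.List.Relation.Unary.All using (All)
open import Data.List.Relation.Unary.Unique.Propositional using (Unique)
open import Data.Nat using (ℕ; _∸_; _≤_; NonZero)
open import Data.Product using (∃; ∃!; _×_)
open import Level using (0ℓ)
open import Relation.Binary.Construct.Closure.ReflexiveTransitive using (Star; ε; _◅_)
open import Relation.Binary.PropositionalEquality using (_≡_)
open import Relation.Nullary using (yes; no)
open import Relation.Unary using (Pred)

record Digraph : Set where
  field
    order        : ℕ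
    .{{nonZero}} : NonZero order
    N⁺           : Fin order → Subset order
    loopless     : ∀ v → v ∉ N⁺ v

  Vertex : Set
  Vertex = Fin order

  _⟶_ : Vertex → Vertex → Set
  u ⟶ v = v ∈ N⁺ u

  deg⁺ : Vertex → ℕ
  deg⁺ v = ∣ N⁺ v ∣

  -- The first argument of min only serves as a default; since every
  -- out-degree is at most the order, it does not affect the minimum.
  δ⁺ : ℕ
  δ⁺ = min order (map deg⁺ (allFin order))

  Walk : Vertex → Vertex → Set
  Walk = Star _⟶_

  vertices : ∀ {u v} → Walk u v → List Vertex
  vertices {u} ε       = u ∷ []
  vertices {u} (_ ◅ w) = u ∷ vertices w

  -- A directed path closed up by an arc. As there are no loops, the path
  -- has at least two vertices; digons are included.
  record Cycle : Set where
    field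
      {start end} : Vertex
      path        : Walk start end
      distinct    : Unique (vertices path)
      closing     : end ⟶ start

  cycleVertices : Cycle → List Vertex
  cycleVertices C = vertices (Cycle.path C)

  cycleLength : Cycle → ℕ
  cycleLength C = length (cycleVertices C)

  Normal : Subset order → Pred Vertex 0ℓ → Set
  Normal Z S =
    (∀ v → S v → v ∉ Z) ×
    (∀ {u v} (w : Walk u v) → S u → S v →
       All (_∉ Z) (vertices w) → All S (vertices w))

record OutArborescence : Set where
  field
    digraph : Digraph
    root    : Digraph.Vertex digraph

  open Digraph digraph public using (Vertex; _⟶_; Walk; N⁺; order)

  field
    uniqueWalk : ∀ t → ∃ λ (w : Walk root t) → ∀ w′ → w ≡ w′

  -- The tree order r ≤ r′.
  _≼_ : Vertex → Vertex → Set
  _≼_ = Walk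

record DirectedTreeDecomposition (D : Digraph) : Set where
  private module D = Digraph D

  field
    arborescence : OutArborescence

  private module T = OutArborescence arborescence

  field
    β : T.Vertex → Subset D.order
    γ : ∀ s t → s T.⟶ t → Subset D.order

  -- The union of the bags β t′ over all t′ with e < t′, where t is the head of e.
  β≽ : T.Vertex → Pred D.Vertex 0ℓ
  β≽ t v = ∃ λ t′ → t T.≼ t′ × v ∈ β t′

  field
    β-nonempty  : ∀ t → Nonempty (β t)
    β-partition : ∀ v → ∃! _≡_ (λ t → v ∈ β t)
    γ-normal    : ∀ s t (e : s T.⟶ t) → D.Normal (γ s t e) (β≽ t)

  -- γ extended by the empty set to pairs (s , t) that are not arcs.
  γ̂ : T.Vertex → T.Vertex → Subset D.order
  γ̂ s t with t ∈? T.N⁺ s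
  ... | yes e = γ s t e
  ... | no  _ = ⊥

  Γ : T.Vertex → Subset D.order
  Γ t = β t ∪ ⋃ (map (λ s → γ̂ s t ∪ γ̂ t s) (allFin T.order))

  -- Truncated subtraction is exact here: the bags are non-empty.
  width : ℕ
  width = max 0 (map (λ t → ∣ Γ t ∣) (allFin T.order)) ∸ 1

-- dtw(D) = w, i.e. w is the smallest width of a directed tree-decomposition.
record HasDirectedTreeWidth (D : Digraph) (w : ℕ) : Set where
  open DirectedTreeDecomposition using (width)
  field
    attained : ∃ λ (𝒯 : DirectedTreeDecomposition D) → width 𝒯 ≡ w
    minimal  : ∀ (𝒯 : DirectedTreeDecomposition D) → w ≤ width 𝒯

{-# OPTIONS --safe #-}
module Submission where

-- Induct on k for induced subdigraphs D[X], all with the same decomposition: it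
-- suffices to find disjoint A, B ⊆ X such that every vertex loses at most d + 1
-- out-neighbours on passing from X to its part. Induction gives k − 1 cycles in
-- A; in D[B] the out-degrees are at least k, so the end of a maximal path closes
-- cycles of k different lengths, one of which is new.
--
-- To find A and B, call a node t with incoming arc e closed if no arc of D[X]
-- leaves the part of D below t except into γ(e). The root is closed. Below a
-- closed t, a terminal strong component B of D[X] − Γ(t) exists, and by
-- normality it lies below a single child s of t. Descend to s as long as s is
-- closed; otherwise some arc leaves the part below s without entering γ(t,s),
-- and what is reachable from its head in D[X] − γ(t,s) serves as A, which by
-- normality does not meet the part below s.

open import Defs
open import Data.Fin using (Fin; zero; suc; _≟_)
open import Data.Fin.Properties using (any?)
open import Data.Fin.Subset
  using (Subset; _∈_; _∉_; _⊆_; _⊂_; _∩_; _∪_; ∁; ⁅_⁆; ⊤; ⊥; ⋃; ∣_∣; Nonempty; inside; outside)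
open import Data.Fin.Subset.Induction using (Acc; acc; ⊂-wellFounded; ⊃-wellFounded)
open import Data.Fin.Subset.Properties
open import Data.List using (List; []; _∷_; _++_; length; tabulate)
open import Data.List.Extrema.Nat using (min≤xs; xs≤max)
open import Data.List.Membership.Propositional using () renaming (_∈_ to _∈ˡ_; _∉_ to _∉ˡ_)
open import Data.List.Membership.Propositional.Properties
  using (∈-allFin; ∈-map⁺; ∈-tabulate⁺; ∈-++⁺ˡ; ∈-++⁺ʳ)
open import Data.List.Properties using (length-tabulate)
open import Data.List.Relation.Binary.Disjoint.Propositional using (Disjoint)
open import Data.List.Relation.Unary.All as All using (All; []; _∷_)
import Data.List.Relation.Unary.All.Properties as All
open import Data.List.Relation.Unary.AllPairs using ([]; _∷_)
open import Data.List.Relation.Unary.Any as Any using (here; there)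
open import Data.List.Relation.Unary.Unique.Propositional using (Unique)
import Data.List.Relation.Unary.Unique.Propositional.Properties as Unique
open import Data.Nat using (ℕ; zero; suc; _+_; _*_; _∸_; _≤_; _<_; _>_; z≤n; s≤s; NonZero)
import Data.Nat as ℕ
open import Data.Nat.Properties hiding (_≟_)
open import Data.Nat.Tactic.RingSolver using (solve-∀)
open import Data.Product using (∃; ∃₂; _×_; _,_; proj₁; proj₂)
open import Data.Sum using (inj₁; inj₂)
open import Data.Vec using ([]; _∷_)
open import Function using (_∘_)
open import Level using (0ℓ)
open import Relation.Binary.Construct.Closure.ReflexiveTransitive using (Star; ε; _◅_; _◅◅_)
open import Relation.Binary.PropositionalEquality
  using (_≡_; _≢_; refl; sym; cong; subst)
open import Relation.Nullary using (¬_; Dec; yes; no; contradiction; map′; ¬?; _×-dec_)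
open import Relation.Unary using (Pred)

-- Cardinalities of finite sets and a pigeonhole principle.

∣p∪q∣≤∣p∣+∣q∣ : ∀ {n} (p q : Subset n) → ∣ p ∪ q ∣ ≤ ∣ p ∣ + ∣ q ∣
∣p∪q∣≤∣p∣+∣q∣ []            []            = z≤n
∣p∪q∣≤∣p∣+∣q∣ (outside ∷ p) (outside ∷ q) = ∣p∪q∣≤∣p∣+∣q∣ p q
∣p∪q∣≤∣p∣+∣q∣ (outside ∷ p) (inside  ∷ q) =
  ≤-trans (s≤s (∣p∪q∣≤∣p∣+∣q∣ p q)) (≤-reflexive (sym (+-suc ∣ p ∣ ∣ q ∣)))
∣p∪q∣≤∣p∣+∣q∣ (inside  ∷ p) (outside ∷ q) = s≤s (∣p∪q∣≤∣p∣+∣q∣ p q)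
∣p∪q∣≤∣p∣+∣q∣ (inside  ∷ p) (inside  ∷ q) =
  s≤s (≤-trans (∣p∪q∣≤∣p∣+∣q∣ p q) (+-monoʳ-≤ ∣ p ∣ (n≤1+n ∣ q ∣)))

∣q∣<∣p∣⇒p⊈q : ∀ {n} (p q : Subset n) → ∣ q ∣ < ∣ p ∣ → ∃ λ x → x ∈ p × x ∉ q
∣q∣<∣p∣⇒p⊈q p q ∣q∣<∣p∣ with any? (λ x → x ∈? p ×-dec ¬? (x ∈? q))
... | yes found = found
... | no  none  = contradiction (p⊆q⇒∣p∣≤∣q∣ p⊆q) (<⇒≱ ∣q∣<∣p∣)
  where
  p⊆q : p ⊆ q
  p⊆q {x} x∈p with x ∈? q
  ... | yes x∈q = x∈q
  ... | no  x∉q = contradiction (x , x∈p , x∉q) none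

x∈⋃⁺ : ∀ {n} {x : Fin n} {p ps} → p ∈ˡ ps → x ∈ p → x ∈ ⋃ ps
x∈⋃⁺ (here refl)  x∈p = x∈p∪q⁺ (inj₁ x∈p)
x∈⋃⁺ (there p∈ps) x∈p = x∈p∪q⁺ (inj₂ (x∈⋃⁺ p∈ps x∈p))

-- Induction on `ℓs`: by injectivity each listed value rules out at most one element of `p`.
injective⇒avoids : ∀ {n} (f : Fin n → ℕ) (ℓs : List ℕ) (p : Subset n) →
  (∀ {x y} → x ∈ p → y ∈ p → f x ≡ f y → x ≡ y) →
  length ℓs < ∣ p ∣ → ∃ λ x → x ∈ p × f x ∉ˡ ℓs
injective⇒avoids {n} f [] p inj ∣ℓs∣<∣p∣ =
  let x , x∈p , _ = ∣q∣<∣p∣⇒p⊈q p ⊥ (subst (_< ∣ p ∣) (sym (∣⊥∣≡0 n)) ∣ℓs∣<∣p∣)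
  in x , x∈p , λ ()
injective⇒avoids f (ℓ ∷ ℓs) p inj ∣ℓs∣<∣p∣ with any? (λ y → y ∈? p ×-dec f y ℕ.≟ ℓ)
... | no none =
  let x , x∈p , fx∉ℓs = injective⇒avoids f ℓs p inj (<-trans (n<1+n _) ∣ℓs∣<∣p∣)
  in x , x∈p , λ { (here fx≡ℓ) → none (x , x∈p , fx≡ℓ) ; (there fx∈ℓs) → fx∉ℓs fx∈ℓs }
... | yes (y , y∈p , refl) = x , p∩q⊆p p _ x∈p-y , f-avoids
  where
  p-y = p ∩ ∁ ⁅ y ⁆

  split : p ⊆ ⁅ y ⁆ ∪ p-y
  split {z} z∈p with z ∈? ⁅ y ⁆
  ... | yes z∈y = x∈p∪q⁺ (inj₁ z∈y)
  ... | no  z∉y = x∈p∪q⁺ (inj₂ (x∈p∩q⁺ (z∈p , x∉p⇒x∈∁p z∉y)))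

  ∣p∣≤1+∣p-y∣ : ∣ p ∣ ≤ suc ∣ p-y ∣
  ∣p∣≤1+∣p-y∣ = ≤-trans (p⊆q⇒∣p∣≤∣q∣ split)
    (≤-trans (∣p∪q∣≤∣p∣+∣q∣ ⁅ y ⁆ p-y) (≤-reflexive (cong (_+ ∣ p-y ∣) (∣⁅x⁆∣≡1 y))))

  rec = injective⇒avoids f ℓs p-y (λ a b → inj (p∩q⊆p p _ a) (p∩q⊆p p _ b))
          (ℕ.s≤s⁻¹ (≤-trans ∣ℓs∣<∣p∣ ∣p∣≤1+∣p-y∣))
  x     = proj₁ rec
  x∈p-y = proj₁ (proj₂ rec)

  f-avoids : f x ∉ˡ f y ∷ ℓs
  f-avoids (there fx∈ℓs) = proj₂ (proj₂ rec) fx∈ℓs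
  f-avoids (here fx≡fy)  =
    x∈∁p⇒x∉p (p∩q⊆q p _ x∈p-y)
      (subst (_∈ ⁅ y ⁆) (sym (inj (p∩q⊆p p _ x∈p-y) y∈p fx≡fy)) (x∈⁅x⁆ y))

-- Reachability and terminal strong components.

module Reachability {n} (N : Fin n → Subset n) where

  _⇝_ : Fin n → Fin n → Set
  _⇝_ = Star (λ u v → v ∈ N u)

  private
    -- Missing out-neighbours are added one at a time; the set grows strictly, so the recursion runs
    -- along strict supersets.
    saturate : ∀ x p → Acc (λ q r → r ⊂ q) p → x ∈ p → (∀ {y} → y ∈ p → x ⇝ y) →
      ∃ λ q → x ∈ q × (∀ {y} → y ∈ q → x ⇝ y) × (∀ {u v} → u ∈ q → v ∈ N u → v ∈ q)
    saturate x p (acc rs) x∈p sound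
      with any? (λ u → any? (λ v → u ∈? p ×-dec v ∈? N u ×-dec ¬? (v ∈? p)))
    ... | yes (u , v , u∈p , v∈Nu , v∉p) =
      saturate x (p ∪ ⁅ v ⁆) (rs (p⊆p∪q _ , v , q⊆p∪q p _ (x∈⁅x⁆ v) , v∉p)) (p⊆p∪q _ x∈p) sound′
      where
      sound′ : ∀ {y} → y ∈ p ∪ ⁅ v ⁆ → x ⇝ y
      sound′ y∈ with x∈p∪q⁻ p _ y∈
      ... | inj₁ y∈p = sound y∈p
      ... | inj₂ y∈v with refl ← x∈⁅y⁆⇒x≡y v y∈v = sound u∈p ◅◅ (v∈Nu ◅ ε)
    ... | no none = p , x∈p , sound , closed
      where
      closed : ∀ {u v} → u ∈ p → v ∈ N u → v ∈ p
      closed {u} {v} u∈p v∈Nu with v ∈? p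
      ... | yes v∈p = v∈p
      ... | no  v∉p = contradiction (u , v , u∈p , v∈Nu , v∉p) none

    saturated : ∀ x → _
    saturated x = saturate x ⁅ x ⁆ (⊃-wellFounded _) (x∈⁅x⁆ x)
      (λ y∈x → subst (x ⇝_) (sym (x∈⁅y⁆⇒x≡y x y∈x)) ε)

  reach : Fin n → Subset n
  reach x = proj₁ (saturated x)

  reach⁻ : ∀ {x y} → y ∈ reach x → x ⇝ y
  reach⁻ {x} = proj₁ (proj₂ (proj₂ (saturated x)))

  reach-closed : ∀ {x u v} → u ∈ reach x → v ∈ N u → v ∈ reach x
  reach-closed {x} = proj₂ (proj₂ (proj₂ (saturated x)))

  reach⁺ : ∀ {x y} → x ⇝ y → y ∈ reach x
  reach⁺ {x} = go (proj₁ (proj₂ (saturated x)))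
    where
    go : ∀ {u y} → u ∈ reach x → u ⇝ y → y ∈ reach x
    go u∈ ε       = u∈
    go u∈ (a ◅ w) = go (reach-closed u∈ a) w

  reach-⊆ : ∀ {x y} → x ⇝ y → reach y ⊆ reach x
  reach-⊆ x⇝y z∈ = reach⁺ (x⇝y ◅◅ reach⁻ z∈)

  reach-⊂ : ∀ {x y} → x ⇝ y → ¬ y ⇝ x → reach y ⊂ reach x
  reach-⊂ x⇝y ¬y⇝x = reach-⊆ x⇝y , _ , reach⁺ ε , ¬y⇝x ∘ reach⁻

  -- While some reachable vertex cannot reach back, moving to it shrinks the reachable set strictly.
  -- At the end `reach y` is a terminal strong component.
  bottom : ∀ x → ∃ λ y → x ⇝ y × (∀ {z} → y ⇝ z → z ⇝ y)
  bottom x = go x (⊂-wellFounded (reach x))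
    where
    go : ∀ x → Acc _⊂_ (reach x) → ∃ λ y → x ⇝ y × (∀ {z} → y ⇝ z → z ⇝ y)
    go x (acc rs) with any? (λ y → y ∈? reach x ×-dec ¬? (x ∈? reach y))
    ... | yes (y , y∈ , x∉) =
      let z , y⇝z , back = go y (rs (reach-⊂ (reach⁻ y∈) (x∉ ∘ reach⁺)))
      in z , reach⁻ y∈ ◅◅ y⇝z , back
    ... | no none = x , ε , back
      where
      back : ∀ {z} → x ⇝ z → z ⇝ x
      back {z} x⇝z with x ∈? reach z
      ... | yes x∈ = reach⁻ x∈
      ... | no  x∉ = contradiction (z , reach⁺ x⇝z , x∉) none

-- Walks, maximal paths and cycles of many lengths.

module Walks (D : Digraph) where
  open Digraph D

  start∈ : ∀ {u v} (w : Walk u v) → u ∈ˡ vertices w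
  start∈ ε       = here refl
  start∈ (_ ◅ _) = here refl

  vertices-snoc : ∀ {u v z} (w : Walk u v) (a : v ⟶ z) →
    vertices (w ◅◅ (a ◅ ε)) ≡ vertices w ++ z ∷ []
  vertices-snoc ε       a = refl
  vertices-snoc (b ◅ w) a = cong (_ ∷_) (vertices-snoc w a)

  length-vertices-◅◅ : ∀ {u v x z} (w : Walk u v) (a : v ⟶ x) (w′ : Walk x z) →
    length (vertices w) < length (vertices (w ◅◅ (a ◅ w′)))
  length-vertices-◅◅ ε       a ε       = ≤-refl
  length-vertices-◅◅ ε       a (_ ◅ _) = s≤s (s≤s z≤n)
  length-vertices-◅◅ (b ◅ w) a w′      = s≤s (length-vertices-◅◅ w a w′)

  -- The number of vertices of the part of the walk from the first occurrence
  -- of x on; vertices off the walk get the value 1.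
  suffixLength : ∀ {u v} → Walk u v → Vertex → ℕ
  suffixLength ε x = 1
  suffixLength (_◅_ {u} a w) x with u ≟ x
  ... | yes _ = suc (length (vertices w))
  ... | no  _ = suffixLength w x

  suffixLength≤ : ∀ {u v} (w : Walk u v) x → suffixLength w x ≤ length (vertices w)
  suffixLength≤ ε x = ≤-refl
  suffixLength≤ (_◅_ {u} a w) x with u ≟ x
  ... | yes _ = ≤-refl
  ... | no  _ = m≤n⇒m≤1+n (suffixLength≤ w x)

  suffixLength-injective : ∀ {u v} (w : Walk u v) {x y} →
    x ∈ˡ vertices w → y ∈ˡ vertices w → suffixLength w x ≡ suffixLength w y → x ≡ y
  suffixLength-injective ε (here refl) (here refl) eq = refl
  suffixLength-injective (_◅_ {u} a w) {x} {y} x∈ y∈ eq with u ≟ x | u ≟ y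
  ... | yes refl | yes refl = refl
  -- The suffix from the head is the whole walk, hence longer than any suffix of the tail `w`.
  ... | yes refl | no _     = contradiction (suffixLength≤ w y) (<⇒≱ (≤-reflexive eq))
  ... | no _     | yes refl = contradiction (suffixLength≤ w x) (<⇒≱ (≤-reflexive (sym eq)))
  ... | no u≢x   | no u≢y   =
    suffixLength-injective w (Any.tail (u≢x ∘ sym) x∈) (Any.tail (u≢y ∘ sym) y∈) eq

  suffix : ∀ {u v x} {P : Pred Vertex 0ℓ} (w : Walk u v) →
    x ∈ˡ vertices w → Unique (vertices w) → All P (vertices w) →
    ∃ λ (w′ : Walk x v) → Unique (vertices w′) × All P (vertices w′) ×
      length (vertices w′) ≡ suffixLength w x
  suffix ε (here refl) uniq all = ε , uniq , all , refl
  suffix {x = x} (_◅_ {u} a w) x∈ uniq all with u ≟ x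
  ... | yes refl = a ◅ w , uniq , all , refl
  suffix (a ◅ w) x∈ (_ ∷ uniq) (_ ∷ all) | no u≢x = suffix w (Any.tail (u≢x ∘ sym) x∈) uniq all

  maximalPath : ∀ (X : Subset order) {v} → v ∈ X →
    ∃₂ λ x y → ∃ λ (w : Walk x y) → Unique (vertices w) × All (_∈ X) (vertices w) ×
      y ∈ X × (∀ {z} → z ∈ N⁺ y → z ∈ X → z ∈ˡ vertices w)
  maximalPath X {v} v∈X = extend (∁ ⁅ v ⁆) (⊂-wellFounded _) ε ([] ∷ []) (v∈X ∷ []) v∈X
    (λ { z∈∁v (here refl) → x∈∁p⇒x∉p z∈∁v (x∈⁅x⁆ v) })
    (λ z∉∁v → here (x∈⁅y⁆⇒x≡y v (x∉∁p⇒x∈p z∉∁v)))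
    where
    -- `U` is the complement of the vertices of `w`. Each new end vertex shrinks it, so the
    -- extension stops.
    extend : ∀ U → Acc _⊂_ U → ∀ {x y} (w : Walk x y) →
      Unique (vertices w) → All (_∈ X) (vertices w) → y ∈ X →
      (∀ {z} → z ∈ U → z ∉ˡ vertices w) → (∀ {z} → z ∉ U → z ∈ˡ vertices w) →
      ∃₂ λ x y → ∃ λ (w : Walk x y) → Unique (vertices w) × All (_∈ X) (vertices w) ×
        y ∈ X × (∀ {z} → z ∈ N⁺ y → z ∈ X → z ∈ˡ vertices w)
    extend U (acc rs) {x} {y} w uniq all y∈X unvisited visited
      with any? (λ z → z ∈? N⁺ y ×-dec z ∈? X ×-dec z ∈? U)
    ... | no none = x , y , w , uniq , all , y∈X , saturated
      where
      saturated : ∀ {z} → z ∈ N⁺ y → z ∈ X → z ∈ˡ vertices w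
      saturated {z} y⟶z z∈X with z ∈? U
      ... | yes z∈U = contradiction (z , y⟶z , z∈X , z∈U) none
      ... | no  z∉U = visited z∉U
    ... | yes (z , y⟶z , z∈X , z∈U) =
      extend (U ∩ ∁ ⁅ z ⁆)
        (rs (p∩q⊆p U _ , z , z∈U , λ z∈ → x∈∁p⇒x∉p (p∩q⊆q U _ z∈) (x∈⁅x⁆ z)))
        (w ◅◅ (y⟶z ◅ ε))
        (subst Unique (sym snoc) (Unique.++⁺ uniq ([] ∷ [])
          λ { (z∈w , here refl) → unvisited z∈U z∈w }))
        (subst (All (_∈ X)) (sym snoc) (All.++⁺ all (z∈X ∷ [])))
        z∈X unvisited′ visited′
      where
      snoc = vertices-snoc w y⟶z

      unvisited′ : ∀ {x} → x ∈ U ∩ ∁ ⁅ z ⁆ → x ∉ˡ vertices (w ◅◅ (y⟶z ◅ ε))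
      unvisited′ {x} x∈ x∈w with x ≟ z
      ... | yes refl = x∈∁p⇒x∉p (p∩q⊆q U _ x∈) (x∈⁅x⁆ z)
      ... | no x≢z   = All.All¬⇒¬Any
        (All.++⁺ (All.¬Any⇒All¬ _ (unvisited (p∩q⊆p U _ x∈))) (x≢z ∷ []))
        (subst (x ∈ˡ_) snoc x∈w)

      visited′ : ∀ {x} → x ∉ U ∩ ∁ ⁅ z ⁆ → x ∈ˡ vertices (w ◅◅ (y⟶z ◅ ε))
      visited′ {x} x∉ rewrite snoc with x ∈? U | x ≟ z
      ... | no x∉U  | _        = ∈-++⁺ˡ (visited x∉U)
      ... | yes _   | yes refl = ∈-++⁺ʳ (vertices w) (here refl)
      ... | yes x∈U | no x≢z   =
        contradiction (x∈p∩q⁺ (x∈U , x∉p⇒x∈∁p (x≢z ∘ x∈⁅y⁆⇒x≡y z))) x∉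

  -- All out-neighbours of the end of a maximal path lie on the path, and each
  -- of them closes a cycle of a different length.
  cycleAvoidingLengths : ∀ (X : Subset order) (ℓs : List ℕ) → Nonempty X →
    (∀ {v} → v ∈ X → length ℓs < ∣ N⁺ v ∩ X ∣) →
    ∃ λ C → All (_∈ X) (cycleVertices C) × cycleLength C ∉ˡ ℓs
  cycleAvoidingLengths X ℓs (v , v∈X) deg =
    let x , y , w , uniq , all , y∈X , sat = maximalPath X v∈X
        ∈w : ∀ {z} → z ∈ N⁺ y ∩ X → z ∈ˡ vertices w
        ∈w z∈ = sat (p∩q⊆p (N⁺ y) X z∈) (p∩q⊆q (N⁺ y) X z∈)
        z , z∈ , new = injective⇒avoids (suffixLength w) ℓs (N⁺ y ∩ X)
          (λ a b → suffixLength-injective w (∈w a) (∈w b)) (deg y∈X)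
        w′ , uniq′ , all′ , len = suffix w (∈w z∈) uniq all
    in record { path = w′ ; distinct = uniq′ ; closing = p∩q⊆p (N⁺ y) X z∈ }
       , all′ , subst (_∉ˡ ℓs) (sym len) new

  -- Induced subdigraphs and normality.

  N⁺[_] : Subset order → Vertex → Subset order
  N⁺[ Y ] v = N⁺ v ∩ Y

  -- Only heads of arcs are restricted to `Y`, so a walk may start outside it. `descend` needs this
  -- for a leaving arc whose tail is only known to lie below `s`.
  module Within (Y : Subset order) where
    open Reachability N⁺[ Y ] public

    ⇝-preserves : ∀ {P : Pred Vertex 0ℓ} → (∀ {u v} → u ⟶ v → v ∈ Y → P u → P v) →
      ∀ {u v} → u ⇝ v → P u → P v
    ⇝-preserves step ε       Pu = Pu
    ⇝-preserves step (a ◅ w) Pu =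
      ⇝-preserves step w (step (p∩q⊆p (N⁺ _) Y a) (p∩q⊆q (N⁺ _) Y a) Pu)

    reach-within : ∀ {v} → v ∈ Y → reach v ⊆ Y
    reach-within v∈Y z∈ = ⇝-preserves (λ _ z∈Y _ → z∈Y) (reach⁻ z∈) v∈Y

    walk : ∀ {u v} → u ⇝ v → Walk u v
    walk ε       = ε
    walk (a ◅ w) = p∩q⊆p (N⁺ _) Y a ◅ walk w

    walk-avoids : ∀ {Z u v} → (∀ {x} → x ∈ Y → x ∉ Z) → u ∉ Z →
      (w : u ⇝ v) → All (_∉ Z) (vertices (walk w))
    walk-avoids disj u∉Z ε       = u∉Z ∷ []
    walk-avoids disj u∉Z (a ◅ w) = u∉Z ∷ walk-avoids disj (disj (p∩q⊆q (N⁺ _) Y a)) w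

    midpoint : ∀ {u v x} (p : u ⇝ v) (q : v ⇝ x) → v ∈ˡ vertices (walk (p ◅◅ q))
    midpoint ε       q = start∈ (walk q)
    midpoint (_ ◅ p) q = there (midpoint p q)

    -- The combined walk avoids `Z`: its first vertex lies in `S`, all later ones in `Y`. Normality
    -- then captures the midpoint.
    normal-convex : ∀ {Z S} → Normal Z S → (∀ {x} → x ∈ Y → x ∉ Z) →
      ∀ {u v x} → u ⇝ v → v ⇝ x → S u → S x → S v
    normal-convex (S∩Z=∅ , returns) disj p q Su Sx =
      All.lookup (returns (walk (p ◅◅ q)) Su Sx (walk-avoids disj (S∩Z=∅ _ Su) (p ◅◅ q)))
        (midpoint p q)

  ∣N⁺∩X∣≤∣N⁺∩A∣+∣Z∣ : ∀ (X A Z : Subset order) v →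
    (∀ {x} → x ∈ N⁺ v → x ∈ X ∩ ∁ Z → x ∈ A) → ∣ N⁺ v ∩ X ∣ ≤ ∣ N⁺ v ∩ A ∣ + ∣ Z ∣
  ∣N⁺∩X∣≤∣N⁺∩A∣+∣Z∣ X A Z v closed = ≤-trans (p⊆q⇒∣p∣≤∣q∣ cover) (∣p∪q∣≤∣p∣+∣q∣ (N⁺ v ∩ A) Z)
    where
    cover : N⁺ v ∩ X ⊆ (N⁺ v ∩ A) ∪ Z
    cover {x} x∈ with x ∈? Z
    ... | yes x∈Z = x∈p∪q⁺ (inj₂ x∈Z)
    ... | no  x∉Z = let x∈N , x∈X = x∈p∩q⁻ (N⁺ v) X x∈ in
      x∈p∪q⁺ (inj₁ (x∈p∩q⁺ (x∈N , closed x∈N (x∈p∩q⁺ (x∈X , x∉p⇒x∈∁p x∉Z)))))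

-- Acyclicity of out-arborescences.

module OutArborescenceProperties (T : OutArborescence) where
  open OutArborescence T
  open Reachability N⁺ public

  -- A walk from `t` back to `s` would yield a second, longer walk from the root to `s`.
  acyclic : ∀ {s t} → s ⟶ t → ¬ t ≼ s
  acyclic {s} a t≼s =
    let w , unique = uniqueWalk s
    in <-irrefl (cong (length ∘ Digraph.vertices digraph) (unique (w ◅◅ (a ◅ t≼s))))
                (Walks.length-vertices-◅◅ digraph w a t≼s)

-- Splitting an induced subdigraph along the tree-decomposition.

module Decomposition (D : Digraph) (𝒯 : DirectedTreeDecomposition D) where
  open Digraph D
  open Walks D
  open DirectedTreeDecomposition 𝒯
  private
    module T = OutArborescence arborescence
    module TP = OutArborescenceProperties arborescence

  β⊆Γ : ∀ t → β t ⊆ Γ t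
  β⊆Γ t = p⊆p∪q _

  γ̂⊆Γ-tail : ∀ s t → γ̂ s t ⊆ Γ s
  γ̂⊆Γ-tail s t v∈ = q⊆p∪q (β s) _ (x∈⋃⁺ (∈-map⁺ _ (∈-allFin t)) (q⊆p∪q (γ̂ t s) _ v∈))

  γ̂⊆Γ-head : ∀ s t → γ̂ s t ⊆ Γ t
  γ̂⊆Γ-head s t v∈ = q⊆p∪q (β t) _ (x∈⋃⁺ (∈-map⁺ _ (∈-allFin s)) (p⊆p∪q _ v∈))

  γ̂-normal : ∀ {s t} → s T.⟶ t → Normal (γ̂ s t) (β≽ t)
  γ̂-normal {s} {t} e with t ∈? T.N⁺ s
  ... | yes e′ = γ-normal s t e′
  ... | no  ∄e = contradiction e ∄e

  ∣Γ∣≤1+width : ∀ t → ∣ Γ t ∣ ≤ suc width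
  ∣Γ∣≤1+width t = ≤-trans (All.lookup (xs≤max 0 _) (∈-map⁺ (∣_∣ ∘ Γ) (∈-allFin t))) (m≤1+[m∸1] _)
    where
    m≤1+[m∸1] : ∀ m → m ≤ suc (m ∸ 1)
    m≤1+[m∸1] zero    = z≤n
    m≤1+[m∸1] (suc m) = ≤-refl

  β≽? : ∀ t v → Dec (β≽ t v)
  β≽? t v = map′ (λ (s , s∈ , v∈) → s , TP.reach⁻ s∈ , v∈) (λ (s , w , v∈) → s , TP.reach⁺ w , v∈)
    (any? (λ s → s ∈? TP.reach t ×-dec v ∈? β s))

  β≽-root : ∀ v → β≽ T.root v
  β≽-root v = let t , v∈ , _ = β-partition v in t , proj₁ (T.uniqueWalk t) , v∈

  record Splitting (X : Subset order) : Set where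
    field
      A B       : Subset order
      A⊆X       : A ⊆ X
      B⊆X       : B ⊆ X
      disjoint  : ∀ {v} → v ∈ A → v ∉ B
      A≠∅       : Nonempty A
      B≠∅       : Nonempty B
      A-degrees : ∀ {v} → v ∈ A → ∣ N⁺ v ∩ X ∣ ≤ ∣ N⁺ v ∩ A ∣ + suc width
      B-degrees : ∀ {v} → v ∈ B → ∣ N⁺ v ∩ X ∣ ≤ ∣ N⁺ v ∩ B ∣ + suc width

  module _ (X : Subset order) (deg : ∀ {v} → v ∈ X → suc width < ∣ N⁺ v ∩ X ∣) where

    -- `Z` stands for the guard of the arc into `t` and is empty at the root. Tails range over all
    -- vertices of `D`, not only those of `X`.
    ClosedUpTo : Subset order → T.Vertex → Set
    ClosedUpTo Z t = ∀ {u v} → u ⟶ v → v ∈ X ∩ ∁ Z → β≽ t u → β≽ t v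

    bottom-below-child : ∀ t Z → Z ⊆ Γ t → ClosedUpTo Z t → ∀ {u} → u ∈ X → β≽ t u →
      ∃ λ s → t T.⟶ s × ∃ λ v → v ∈ X ∩ ∁ (Γ t) ×
        (∀ {x} → x ∈ Within.reach (X ∩ ∁ (Γ t)) v → β≽ s x)
    bottom-below-child t Z Z⊆Γ closed {u} u∈X βu = child βv
      where
      Y = X ∩ ∁ (Γ t)
      open Within Y

      closedΓ : ∀ {u v} → u ⟶ v → v ∈ Y → β≽ t u → β≽ t v
      closedΓ a v∈Y = closed a
        (x∈p∩q⁺ (p∩q⊆p X _ v∈Y , x∉p⇒x∈∁p (x∈∁p⇒x∉p (p∩q⊆q X _ v∈Y) ∘ Z⊆Γ)))

      -- Out-degrees in `X` exceed the bound `suc width` on the size of `Γ t`, so some out-neighbour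
      -- of `u` avoids `Γ t`.
      escape = ∣q∣<∣p∣⇒p⊈q (N⁺ u ∩ X) (Γ t) (≤-<-trans (∣Γ∣≤1+width t) (deg u∈X))
      x  = proj₁ escape
      u⟶x = p∩q⊆p (N⁺ u) X (proj₁ (proj₂ escape))
      x∈Y : x ∈ Y
      x∈Y = x∈p∩q⁺ (p∩q⊆q (N⁺ u) X (proj₁ (proj₂ escape)) , x∉p⇒x∈∁p (proj₂ (proj₂ escape)))

      v = proj₁ (bottom x)
      x⇝v = proj₁ (proj₂ (bottom x))
      back : ∀ {z} → v ⇝ z → z ⇝ v
      back = proj₂ (proj₂ (bottom x))
      v∈Y = reach-within x∈Y (reach⁺ x⇝v)

      βv : β≽ t v
      βv = ⇝-preserves closedΓ x⇝v (closedΓ u⟶x x∈Y βu)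

      child : β≽ t v → ∃ λ s → t T.⟶ s × ∃ λ v → v ∈ Y × (∀ {x} → x ∈ reach v → β≽ s x)
      child (_ , ε , v∈β) = contradiction (β⊆Γ t v∈β) (x∈∁p⇒x∉p (p∩q⊆q X _ v∈Y))
      -- As `v` is not in `β t`, the tree walk to its bag has a first arc, to the child `s`. Every
      -- vertex reached from `v` leads back to `v`, so it lies on a closed walk avoiding `γ̂ t s`.
      child (t′ , _◅_ {j = s} e s≼t′ , v∈β) = s , e , v , v∈Y , λ z∈ →
        normal-convex (γ̂-normal e) (λ y∈Y → x∈∁p⇒x∉p (p∩q⊆q X _ y∈Y) ∘ γ̂⊆Γ-tail t s)
          (reach⁻ z∈) (back (reach⁻ z∈)) (t′ , s≼t′ , v∈β) (t′ , s≼t′ , v∈β)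

    -- The set of tree vertices below `t` shrinks with each step. No leaf case arises, since
    -- `bottom-below-child` always yields a child.
    descend : ∀ t → Acc _⊂_ (TP.reach t) → ∀ Z → Z ⊆ Γ t → ClosedUpTo Z t →
      ∀ {u} → u ∈ X → β≽ t u → Splitting X
    descend t (acc rs) Z Z⊆Γ closed u∈X βu
      with bottom-below-child t Z Z⊆Γ closed u∈X βu
    ... | s , e , b , b∈Y , B⊆β
      with any? (λ u → any? (λ v →
        v ∈? N⁺ u ×-dec v ∈? (X ∩ ∁ (γ̂ t s)) ×-dec β≽? s u ×-dec ¬? (β≽? s v)))
    ... | no none =
      descend s (rs (TP.reach-⊂ (e ◅ ε) (TP.acyclic e))) (γ̂ t s) (γ̂⊆Γ-head t s) closed′
        (p∩q⊆p X _ b∈Y) (B⊆β (Within.reach⁺ _ ε))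
      where
      closed′ : ClosedUpTo (γ̂ t s) s
      closed′ {u} {v} u⟶v v∈ βu with β≽? s v
      ... | yes βv = βv
      ... | no ¬βv = contradiction (u , v , u⟶v , v∈ , βu , ¬βv) none
    ... | yes (u , a , u⟶a , a∈ , βu , ¬βa) = record
      { A         = RA.reach a
      ; B         = RB.reach b
      ; A⊆X       = p∩q⊆p X _ ∘ RA.reach-within a∈
      ; B⊆X       = p∩q⊆p X _ ∘ RB.reach-within b∈Y
      -- A common vertex would lie below `s`, so the walk from `u` through `a` to it would return
      -- there and force `a` below `s`.
      ; disjoint  = λ v∈A v∈B → ¬βa (RA.normal-convex (γ̂-normal e) (x∈∁p⇒x∉p ∘ p∩q⊆q X _)
          (x∈p∩q⁺ (u⟶a , a∈) ◅ ε) (RA.reach⁻ v∈A) βu (B⊆β v∈B))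
      ; A≠∅       = a , RA.reach⁺ ε
      ; B≠∅       = b , RB.reach⁺ ε
      -- `A` loses only vertices of `γ̂ t s`, a subset of `Γ s`, and `B` only vertices of `Γ t`.
      ; A-degrees = λ {v} v∈A → ≤-trans
          (∣N⁺∩X∣≤∣N⁺∩A∣+∣Z∣ X _ (γ̂ t s) v (λ x∈N x∈Y → RA.reach-closed v∈A (x∈p∩q⁺ (x∈N , x∈Y))))
          (+-monoʳ-≤ _ (≤-trans (p⊆q⇒∣p∣≤∣q∣ (γ̂⊆Γ-head t s)) (∣Γ∣≤1+width s)))
      ; B-degrees = λ {v} v∈B → ≤-trans
          (∣N⁺∩X∣≤∣N⁺∩A∣+∣Z∣ X _ (Γ t) v (λ x∈N x∈Y → RB.reach-closed v∈B (x∈p∩q⁺ (x∈N , x∈Y))))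
          (+-monoʳ-≤ _ (∣Γ∣≤1+width t))
      }
      where
      module RA = Within (X ∩ ∁ (γ̂ t s))
      module RB = Within (X ∩ ∁ (Γ t))

    splitting : Nonempty X → Splitting X
    splitting (u , u∈X) =
      -- The empty set serves as guard at the root, since every vertex lies below it.
      descend T.root (⊂-wellFounded _) ⊥ (λ x∈⊥ → contradiction x∈⊥ ∉⊥) (λ _ _ _ → β≽-root _)
        u∈X (β≽-root u)

  -- Induction on the number of cycles.

  DisjointDistinct : ∀ {k} → (Fin k → Cycle) → Set
  DisjointDistinct C = ∀ i j → i ≢ j →
    Disjoint (cycleVertices (C i)) (cycleVertices (C j)) × cycleLength (C i) ≢ cycleLength (C j)

  cons : ∀ {k} → Cycle → (Fin k → Cycle) → Fin (suc k) → Cycle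
  cons C₀ C zero    = C₀
  cons C₀ C (suc i) = C i

  -- `k` is one less than the number of cycles, matching the factor `k - 1` of the theorem.
  disjointCycles : ∀ d → width ≤ d → ∀ k (X : Subset order) → Nonempty X →
    (∀ {v} → v ∈ X → (d + 2) * k < ∣ N⁺ v ∩ X ∣) →
    ∃ λ (C : Fin (suc k) → Cycle) → DisjointDistinct C × (∀ i → All (_∈ X) (cycleVertices (C i)))
  disjointCycles d w≤d zero X X≠∅ deg =
    let C , C⊆X , _ = cycleAvoidingLengths X [] X≠∅ (λ v∈X → ≤-<-trans z≤n (deg v∈X))
    in (λ _ → C) , (λ { zero zero 0≢0 → contradiction refl 0≢0 }) , (λ _ → C⊆X)
  disjointCycles d w≤d (suc k) X X≠∅ deg =
    let C , C-dd , C⊆A = disjointCycles d w≤d k A A≠∅ (λ v∈A →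
          <-trans (n<1+n _) (remaining A (A⊆X v∈A) (A-degrees v∈A)))
        ℓs = tabulate (cycleLength ∘ C)
        -- There are `suc k` lengths to avoid, so `2 + k` out-neighbours are needed in `B`.
        C₀ , C₀⊆B , new = cycleAvoidingLengths B ℓs B≠∅ (λ v∈B →
          ≤-trans (s≤s (≤-reflexive (length-tabulate (cycleLength ∘ C))))
            (≤-trans 2+k≤2+[d+2]k (remaining B (B⊆X v∈B) (B-degrees v∈B))))
        apart : ∀ i → Disjoint (cycleVertices C₀) (cycleVertices (C i))
        apart i (x∈C₀ , x∈Ci) = disjoint (All.lookup (C⊆A i) x∈Ci) (All.lookup C₀⊆B x∈C₀)
        distinct : ∀ i → cycleLength C₀ ≢ cycleLength (C i)
        distinct i eq = new (subst (_∈ˡ ℓs) (sym eq) (∈-tabulate⁺ {f = cycleLength ∘ C} i))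
    in cons C₀ C
       , (λ { zero    zero    0≢0 → contradiction refl 0≢0
            ; zero    (suc j) _   → apart j , distinct j
            ; (suc i) zero    _   → (λ (x∈Ci , x∈C₀) → apart i (x∈C₀ , x∈Ci)) , distinct i ∘ sym
            ; (suc i) (suc j) i≢j → C-dd i j (i≢j ∘ cong suc) })
       , λ { zero → All.map B⊆X C₀⊆B ; (suc i) → All.map A⊆X (C⊆A i) }
    where
    open ≤-Reasoning

    width-bound : suc width < (d + 2) * suc k
    width-bound = begin-strict
      suc width       ≤⟨ s≤s w≤d ⟩
      suc d           <⟨ ≤-reflexive (+-comm 2 d) ⟩
      d + 2           ≤⟨ m≤m*n (d + 2) (suc k) ⟩
      (d + 2) * suc k ∎

    open Splitting (splitting X (<-trans width-bound ∘ deg) X≠∅)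

    2+k≤2+[d+2]k : 2 + k ≤ 2 + (d + 2) * k
    2+k≤2+[d+2]k = +-monoʳ-≤ 2 (m≤n*m k (d + 2) ⦃ ℕ.>-nonZero (≤-trans (n≤1+n 1) (m≤n+m 2 d)) ⦄)

    rearrange : ∀ d k → 2 + (d + 2) * k + suc d ≡ suc ((d + 2) * suc k)
    rearrange = solve-∀

    -- The factor `d + 2` exceeds the loss `d + 1` by one. This raises the surplus from 1 to 2,
    -- which `B` requires when `k` is zero.
    remaining : ∀ {v} Y → v ∈ X → ∣ N⁺ v ∩ X ∣ ≤ ∣ N⁺ v ∩ Y ∣ + suc width →
      2 + (d + 2) * k ≤ ∣ N⁺ v ∩ Y ∣
    remaining {v} Y v∈X loss = +-cancelʳ-≤ (suc d) _ _ (begin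
      2 + (d + 2) * k + suc d     ≡⟨ rearrange d k ⟩
      suc ((d + 2) * suc k)       ≤⟨ deg v∈X ⟩
      ∣ N⁺ v ∩ X ∣                ≤⟨ loss ⟩
      ∣ N⁺ v ∩ Y ∣ + suc width    ≤⟨ +-monoʳ-≤ ∣ N⁺ v ∩ Y ∣ (s≤s w≤d) ⟩
      ∣ N⁺ v ∩ Y ∣ + suc d        ∎)

-- From induced subdigraphs to the whole digraph.

proposition6 : (k d : ℕ) → .{{_ : NonZero k}} → .{{_ : NonZero d}} →
    (D : Digraph) →
    Digraph.δ⁺ D > (d + 2) * (k ∸ 1) →
    (∃ λ w → HasDirectedTreeWidth D w × w ≤ d) →
    ∃ λ (C : Fin k → Digraph.Cycle D) → ∀ i j → i ≢ j →
    Disjoint (Digraph.cycleVertices D (C i)) (Digraph.cycleVertices D (C j)) ×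
    Digraph.cycleLength D (C i) ≢ Digraph.cycleLength D (C j)
proposition6 (suc k) d D δ> (w , hasWidth , w≤d) =
  let 𝒯 , width≡w = HasDirectedTreeWidth.attained hasWidth
      C , C-dd , _ = Decomposition.disjointCycles D 𝒯 d
        (≤-trans (≤-reflexive width≡w) w≤d) k ⊤ (root 𝒯 , ∈⊤) degrees
  in C , C-dd
  where
  open Digraph D

  root : DirectedTreeDecomposition D → Vertex
  root 𝒯 = proj₁ (DirectedTreeDecomposition.β-nonempty 𝒯
    (OutArborescence.root (DirectedTreeDecomposition.arborescence 𝒯)))

  degrees : ∀ {v} → v ∈ ⊤ → (d + 2) * k < ∣ N⁺ v ∩ ⊤ ∣
  degrees {v} _ = ≤-trans δ> (≤-trans (All.lookup (min≤xs order _) (∈-map⁺ deg⁺ (∈-allFin v)))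
    (≤-reflexive (cong ∣_∣ (sym (∩-identityʳ (N⁺ v))))))
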